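{- For every integer $n\ge 0$, the Euler characteristic $\chi(\mathcal{S}_{2,n})=\sum_{d\ge0}(-1)^d c_{n,d}$ of the configuration space $\mathcal{S}_{2,n}$ equals $1$, where $c_{n,d}$ is the number of $d$-dimensional cubes of $\mathcal{S}_{2,n}$.
   Context: **Positions.** A position of the robotic arm of length $n$ in a tunnel of width $2$ is a lattice path of $n$ unit links starting at $(0,0)$, each link facing up ($u$), down ($d$) or right ($r$), staying in the strip $0\le y\le 2$ and not intersecting itself; equivalently a word in $\{u,d,r\}^n$ with no two consecutive letters $ud$ or $du$ and all heights in $[0,2]$. For $n=0$ there is exactly one (empty) position. **Moves.** (Switch corners) two consecutive links facing different directions (one vertical, one horizontal) interchange directions; (flip the end) the last link rotates by $90^\circ$ ($r\leftrightarrow u$ or $r\leftrightarrow d$). A move is legal only if its result is a position. **Configuration space.** $\mathcal{S}_{2,n}$ is the cubical complex whose vertices are the positions, whose edges are the legal moves, and whose $k$-cubes correspond to $k$-tuples of commutative moves: given $k$ moves applicable at a position $p$, acting on pairwise disjoint sets of links and such that performing any subset of them yields a position, the $2^k$ positions obtained from $p$ by performing the subsets of these moves are the vertices of a $k$-cube (a cube is determined by its set of vertices). -}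

module Defs where

open import Data.Bool.Base using (true; false)
open import Data.Fin.Base using (Fin; suc; inject₁; fromℕ)
open import Data.Fin.Subset using (Subset)
open import Data.Integer.Base as ℤ using (ℤ; +_; 0ℤ; 1ℤ; -1ℤ)
open import Data.Nat.Base as ℕ using (ℕ; zero; suc)
open import Data.Product.Base using (_×_; ∃; proj₁; proj₂; _,_)
open import Data.Sum.Base using (_⊎_)
open import Data.Vec.Base using (Vec; []; _∷_; lookup; _[_]≔_)
open import Data.Vec.Relation.Unary.All using (All)
open import Data.Vec.Relation.Unary.AllPairs using (AllPairs)
open import Data.Vec.Relation.Unary.Linked using (Linked)
open import Function.Bundles using (Bijection)
open import Level using (0ℓ)
open import Relation.Binary.Bundles using (Setoid)
open import Relation.Binary.PropositionalEquality using (_≡_; setoid)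
open import Relation.Nullary.Negation using (¬_)
open import Relation.Unary using (Pred; _≐_; _⊥_)

private
  variable
    n k : ℕ

data Link : Set where
  u d r : Link

data Vertical : Pred Link 0ℓ where
  u : Vertical u
  d : Vertical d

data Horizontal : Pred Link 0ℓ where
  r : Horizontal r

data Opposite : Link → Link → Set where
  ud : Opposite u d
  du : Opposite d u

Perpendicular : Link → Link → Set
Perpendicular a b = (Vertical a × Horizontal b) ⊎ (Horizontal a × Vertical b)

rise : Link → ℤ
rise u = 1ℤ
rise d = -1ℤ
rise r = 0ℤ

-- All joints of the path that starts at height y lie at heights in [0,2].
InStrip : ℤ → Vec Link n → Set
InStrip y []      = (0ℤ ℤ.≤ y) × (y ℤ.≤ + 2)
InStrip y (l ∷ w) = ((0ℤ ℤ.≤ y) × (y ℤ.≤ + 2)) × InStrip (y ℤ.+ rise l) w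

-- As no link faces left, a path meets itself only by turning straight back,
-- that is, if u and d are consecutive.
record IsPosition (w : Vec Link n) : Set where
  field
    nonIntersecting : Linked (λ a b → ¬ Opposite a b) w
    inStrip         : InStrip 0ℤ w

-- switch i interchanges links i and i + 1; flip l turns the last link so that
-- it faces l.
data Move : ℕ → Set where
  switch : Fin n → Move (suc n)
  flip   : Link → Move (suc n)

links : Move n → Pred (Fin n) 0ℓ
links (switch i)         j = (j ≡ inject₁ i) ⊎ (j ≡ suc i)
links {n = suc m} (flip _) j = j ≡ fromℕ m

perform : Move n → Vec Link n → Vec Link n
perform (switch i) w =
  (w [ inject₁ i ]≔ lookup w (suc i)) [ suc i ]≔ lookup w (inject₁ i)
perform {n = suc m} (flip l) w = w [ fromℕ m ]≔ l

Turns : Move n → Vec Link n → Set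
Turns (switch i) w = Perpendicular (lookup w (inject₁ i)) (lookup w (suc i))
Turns {n = suc m} (flip l) w = Perpendicular (lookup w (fromℕ m)) l

Applicable : Vec Link n → Move n → Set
Applicable w m = Turns m w × IsPosition (perform m w)

-- Performs the moves selected by the subset.  For moves on pairwise disjoint
-- sets of links the order is immaterial.
performSubset : Vec (Move n) k → Subset k → Vec Link n → Vec Link n
performSubset []       []          w = w
performSubset (m ∷ ms) (true  ∷ s) w = performSubset ms s (perform m w)
performSubset (m ∷ ms) (false ∷ s) w = performSubset ms s w

record Cube (n k : ℕ) : Set where
  field
    base       : Vec Link n
    isPosition : IsPosition base
    moves      : Vec (Move n) k
    applicable : All (Applicable base) moves
    disjoint   : AllPairs (λ m m′ → links m ⊥ links m′) moves
    commute    : ∀ s → IsPosition (performSubset moves s base)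

  vertices : Pred (Vec Link n) 0ℓ
  vertices w = ∃ λ s → performSubset moves s base ≡ w

-- The k-cubes of the configuration space: the same cube arises from several
-- choices of base and moves, so cubes are identified when their vertex sets
-- agree.  The 0-cubes are the positions and the 1-cubes the legal moves.
𝒮₂ : (n k : ℕ) → Setoid 0ℓ 0ℓ
𝒮₂ n k = record
  { Carrier       = Cube n k
  ; _≈_           = λ c c′ → Cube.vertices c ≐ Cube.vertices c′
  ; isEquivalence = record
    { refl  = (λ z → z) , (λ z → z)
    ; sym   = λ p → proj₂ p , proj₁ p
    ; trans = λ p q → (λ z → proj₁ q (proj₁ p z)) , (λ z → proj₂ p (proj₂ q z))
    }
  }

HasCardinality : Setoid 0ℓ 0ℓ → ℕ → Set
HasCardinality A k = Bijection (setoid (Fin k)) A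

alternatingSum : (ℕ → ℕ) → ℕ → ℤ
alternatingSum c zero    = 0ℤ
alternatingSum c (suc N) = alternatingSum c N ℤ.+ (-1ℤ ℤ.^ N) ℤ.* (+ c N)

-- For a complex given by its setoids of k-cubes: there are finitely many cubes
-- in all, and the sum over all k of (-1)^k times the number of k-cubes is χ.
-- Cardinalities are unique and the terms with k ≥ bound vanish, so χ does not
-- depend on the choice of count and bound.
record HasEulerCharacteristic (cubes : ℕ → Setoid 0ℓ 0ℓ) (χ : ℤ) : Set where
  field
    count       : ℕ → ℕ
    cardinality : ∀ k → HasCardinality (cubes k) (count k)
    bound       : ℕ
    vanishing   : ∀ k → bound ℕ.≤ k → count k ≡ 0
    sum         : alternatingSum count bound ≡ χ

{-# OPTIONS --safe #-}
-- The vertex set of a cube is a product of blocks: fixed links, pairs of links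
-- ranging over rv and vr, and possibly a last link ranging over r and v, where
-- v is vertical.  The blocks can be read off the vertex set, so counting cubes
-- amounts to counting such patterns.  Both kinds of moving blocks constrain
-- what follows exactly as a fixed v does, but contribute the opposite sign.
-- Hence the signed number f(m) of patterns of length m that continue a given
-- path satisfies, with f(0) = 1,
--   f(m+1) = f(m) + Σ_v (f(m) - f(m-1)),   f(-1) = 1,
-- where v ranges over the vertical links that may come next, f(-1) accounts for
-- a flipping last link, and each f on the right belongs to the path extended by
-- the first block.  By induction f is 1 for every path.
module Submission where

open import Defs
open import Algebra.Properties.CommutativeSemigroup using (interchange)
open import Data.Bool.Base using (true; false)
open import Data.Empty using (⊥-elim)
open import Data.Fin.Base using (Fin; zero; suc; inject₁)
open import Data.Integer.Base as ℤ using (ℤ; +_; 0ℤ; 1ℤ; -1ℤ)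
import Data.Integer.Properties as ℤ
open import Data.List.Base as List using (List; []; _∷_; _++_; concatMap; filter; length)
open import Data.List.Membership.Propositional using (_∈_; find; lose)
open import Data.List.Membership.Propositional.Properties
  using (∈-lookup; ∈-map⁺; ∈-map⁻; ∈-++⁺ˡ; ∈-++⁺ʳ; ∈-++⁻; ∈-concatMap⁺; ∈-concatMap⁻; ∈-filter⁺; ∈-filter⁻)
open import Data.List.Properties using (length-map; length-++)
open import Data.List.Relation.Unary.All as ListAll using ([]; _∷_)
import Data.List.Relation.Unary.All.Properties as ListAll
import Data.List.Relation.Unary.AllPairs as ListAllPairs
import Data.List.Relation.Unary.AllPairs.Properties as ListAllPairs
open import Data.List.Relation.Unary.Any using (here; there; index)
open import Data.List.Relation.Unary.Any.Properties using (lookup-index)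
open import Data.List.Relation.Unary.Unique.Propositional using (Unique; []; _∷_)
import Data.List.Relation.Unary.Unique.Propositional.Properties as Unique
open import Data.Nat.Base as ℕ using (ℕ; zero; suc; s≤s; z≤n)
import Data.Nat.Properties as ℕ
open import Data.Product.Base using (_×_; _,_; ∃; proj₁; proj₂; map₂)
open import Data.Sum.Base using (_⊎_; inj₁; inj₂)
open import Data.Vec.Base as Vec using (Vec; []; _∷_; lookup; _[_]≔_)
open import Data.Vec.Properties using (lookup∘update′)
open import Data.Vec.Relation.Unary.All as VecAll using (All; []; _∷_)
import Data.Vec.Relation.Unary.All.Properties as VecAll
open import Data.Vec.Relation.Unary.AllPairs as VecAllPairs using (AllPairs; []; _∷_)
import Data.Vec.Relation.Unary.AllPairs.Properties as VecAllPairs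
open import Data.Vec.Relation.Unary.Linked as Linked using (Linked; []; [-]; _∷_)
open import Function.Base using (_∘_)
open import Level using (0ℓ)
open import Relation.Binary.Bundles using (module Setoid)
open import Relation.Binary.Definitions using (Decidable)
open import Relation.Binary.PropositionalEquality
  using (_≡_; refl; sym; trans; cong; cong₂; subst; module ≡-Reasoning)
open import Relation.Nullary.Decidable using (Dec; yes; no; _×-dec_; ¬?)
open import Relation.Nullary.Negation using (¬_; contradiction)
open import Relation.Unary using (Pred; _≐_; _⊆_; _⊥_)

private
  variable
    n k : ℕ
    v l p : Link
    w w′ : Vec Link n
    y : ℤ
    A B : Set

-- Patterns and their vertex sets

-- In swap and end the vertical link v is given by the proof of Vertical v: two
-- links ranging over rv and vr, and a last link ranging over r and v.
data Pattern : ℕ → ℕ → Set where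
  []   : Pattern 0 0
  end  : Vertical v → Pattern 1 1
  _∷_  : Link → Pattern n k → Pattern (suc n) k
  swap : Vertical v → Pattern n k → Pattern (suc (suc n)) (suc k)

data Vertex : Pattern n k → Pred (Vec Link n) 0ℓ where
  []    : Vertex [] []
  endʰ  : (ver : Vertical v) → Vertex (end ver) (r ∷ [])
  endᵛ  : (ver : Vertical v) → Vertex (end ver) (v ∷ [])
  _∷_   : ∀ l {P : Pattern n k} → Vertex P w → Vertex (l ∷ P) (l ∷ w)
  swapʰ : (ver : Vertical v) {P : Pattern n k} → Vertex P w → Vertex (swap ver P) (r ∷ v ∷ w)
  swapᵛ : (ver : Vertical v) {P : Pattern n k} → Vertex P w → Vertex (swap ver P) (v ∷ r ∷ w)

base : Pattern n k → Vec Link n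
base []                 = []
base (end _)            = r ∷ []
base (l ∷ P)            = l ∷ base P
base (swap {v = v} _ P) = r ∷ v ∷ base P

base-vertex : (P : Pattern n k) → Vertex P (base P)
base-vertex []           = []
base-vertex (end ver)    = endʰ ver
base-vertex (l ∷ P)      = l ∷ base-vertex P
base-vertex (swap ver P) = swapʰ ver (base-vertex P)

-- Each moving block occupies at least one link. This bounds the dimensions in which cubes exist.
dimension≤length : Pattern n k → k ℕ.≤ n
dimension≤length []         = z≤n
dimension≤length (end _)    = s≤s z≤n
dimension≤length (_ ∷ P)    = ℕ.m≤n⇒m≤1+n (dimension≤length P)
dimension≤length (swap _ P) = s≤s (ℕ.m≤n⇒m≤1+n (dimension≤length P))

Vertical-irrelevant : (p q : Vertical v) → p ≡ q
Vertical-irrelevant u u = refl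
Vertical-irrelevant d d = refl

∷⁻ : ∀ {l l′} {P : Pattern n k} → Vertex (l ∷ P) (l′ ∷ w) → l ≡ l′ × Vertex P w
∷⁻ (_ ∷ x) = refl , x

swapʰ⁻ : ∀ {v l} {ver : Vertical v} {P : Pattern n k} → Vertex (swap ver P) (r ∷ l ∷ w) → v ≡ l × Vertex P w
swapʰ⁻ (swapʰ _ x) = refl , x
swapʰ⁻ {ver = ()} (swapᵛ _ x)

endᵛ⁻ : ∀ {v l} {ver : Vertical v} → Vertical l → Vertex (end ver) (l ∷ []) → v ≡ l
endᵛ⁻ () (endʰ _)
endᵛ⁻ _ (endᵛ _) = refl

-- The vertices of a swap begin with r as well as with v, and a fixed first link would force r to be
-- vertical.
¬∷⊇swap : ∀ {l} {ver : Vertical v} {P : Pattern (suc n) (suc k)} {Q : Pattern n k} →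
          ¬ (Vertex (swap ver Q) ⊆ Vertex (l ∷ P))
¬∷⊇swap {ver = ver} {Q = Q} sub with sub (swapʰ ver (base-vertex Q)) | sub (swapᵛ ver (base-vertex Q))
¬∷⊇swap {ver = ()} sub | _ ∷ _ | _ ∷ _

-- The blocks are read off from the front. A first link that varies betrays a swap, and the link
-- after a leading r is then its v; prefixing a common block carries vertices of the rest to
-- vertices of the whole.
Vertex-⊆⇒≡ : (P Q : Pattern n k) → Vertex P ⊆ Vertex Q → Vertex Q ⊆ Vertex P → P ≡ Q
Vertex-⊆⇒≡ [] [] _ _ = refl
Vertex-⊆⇒≡ (end p) (end q) p⊆q _ with endᵛ⁻ p (p⊆q (endᵛ p))
... | refl = cong end (Vertical-irrelevant p q)
Vertex-⊆⇒≡ (l ∷ P) (l′ ∷ Q) p⊆q q⊆p with ∷⁻ (p⊆q (l ∷ base-vertex P))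
... | refl , _ = cong (l ∷_)
  (Vertex-⊆⇒≡ P Q (λ x → proj₂ (∷⁻ (p⊆q (l ∷ x)))) (λ x → proj₂ (∷⁻ (q⊆p (l ∷ x)))))
Vertex-⊆⇒≡ (l ∷ P) (swap _ Q) _ q⊆p = ⊥-elim (¬∷⊇swap q⊆p)
Vertex-⊆⇒≡ (swap _ P) (l ∷ Q) p⊆q _ = ⊥-elim (¬∷⊇swap p⊆q)
Vertex-⊆⇒≡ (swap p P) (swap q Q) p⊆q q⊆p with swapʰ⁻ (p⊆q (swapʰ p (base-vertex P)))
... | refl , _ = cong₂ swap (Vertical-irrelevant p q)
  (Vertex-⊆⇒≡ P Q (λ x → proj₂ (swapʰ⁻ (p⊆q (swapʰ p x)))) (λ x → proj₂ (swapʰ⁻ (q⊆p (swapʰ q x)))))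

-- Words that continue a path

InRange : ℤ → Set
InRange y = (0ℤ ℤ.≤ y) × (y ℤ.≤ + 2)

-- w may follow a path that ends at height y with the link p.  As r is opposite
-- to no link, p = r also serves as the start of the path.
Continues : ℤ → Link → Pred (Vec Link n) 0ℓ
Continues y p w = Linked (λ a b → ¬ Opposite a b) (p ∷ w) × InStrip y w

Admissible : ℤ → Link → Pred (∃ Vertical) 0ℓ
Admissible y p (v , _) = InRange (y ℤ.+ rise v) × ¬ Opposite p v

opposite? : Decidable Opposite
opposite? u u = no λ ()
opposite? u d = yes ud
opposite? u r = no λ ()
opposite? d u = yes du
opposite? d d = no λ ()
opposite? d r = no λ ()
opposite? r _ = no λ ()

admissible? : ∀ y p (v : ∃ Vertical) → Dec (Admissible y p v)
admissible? y p (v , _) =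
  ((0ℤ ℤ.≤? y ℤ.+ rise v) ×-dec (y ℤ.+ rise v ℤ.≤? + 2)) ×-dec ¬? (opposite? p v)

-- Enumeration of the patterns that continue a path

verticals : List (∃ Vertical)
verticals = (u , u) ∷ (d , d) ∷ []

turns : ℤ → Link → List (∃ Vertical)
turns y p = filter (admissible? y p) verticals

-- In a swap, vr puts v right after `p`, so v must be admissible there, and rv puts the rest right
-- after v. After vr the rest starts at the same height but follows r, which is less restrictive. So
-- `bent` recurses from the same height and previous link as a fixed v does, one link further on.
patterns : ∀ n k → ℤ → Link → List (Pattern n k)
bent     : ∀ n k → ℤ → Vertical v → List (Pattern (suc n) k)
vertical : ∀ n k → ℤ → ∃ Vertical → List (Pattern (suc n) k)

patterns zero    zero    y p = [] ∷ []
patterns zero    (suc k) y p = []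
patterns (suc n) k       y p =
  List.map (r ∷_) (patterns n k (y ℤ.+ rise r) r) ++ concatMap (vertical n k y) (turns y p)

bent n       zero          y ver = []
bent zero    (suc zero)    y ver = end ver ∷ []
bent zero    (suc (suc k)) y ver = []
bent {v = v} (suc n) (suc k) y ver = List.map (swap ver) (patterns n k (y ℤ.+ rise v) v)

vertical n k y (v , ver) = List.map (v ∷_) (patterns n k (y ℤ.+ rise v) v) ++ bent n k y ver

-- Alternating sums

alternatingSum-cong : ∀ {f g} → (∀ k → f k ≡ g k) → ∀ N → alternatingSum f N ≡ alternatingSum g N
alternatingSum-cong f≗g zero    = refl
alternatingSum-cong f≗g (suc N) =
  cong₂ (λ a b → a ℤ.+ (-1ℤ ℤ.^ N) ℤ.* (+ b)) (alternatingSum-cong f≗g N) (f≗g N)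

alternatingSum-0 : ∀ N → alternatingSum (λ _ → 0) N ≡ 0ℤ
alternatingSum-0 zero    = refl
alternatingSum-0 (suc N) = cong₂ ℤ._+_ (alternatingSum-0 N) (ℤ.*-zeroʳ (-1ℤ ℤ.^ N))

alternatingSum-+ : ∀ f g N →
  alternatingSum (λ k → f k ℕ.+ g k) N ≡ alternatingSum f N ℤ.+ alternatingSum g N
alternatingSum-+ f g zero    = refl
alternatingSum-+ f g (suc N) = begin
  alternatingSum (λ k → f k ℕ.+ g k) N ℤ.+ ε ℤ.* (+ (f N ℕ.+ g N))
    ≡⟨ cong₂ ℤ._+_ (alternatingSum-+ f g N)
         (trans (cong (ε ℤ.*_) (ℤ.pos-+ (f N) (g N))) (ℤ.*-distribˡ-+ ε (+ f N) (+ g N))) ⟩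
  (alternatingSum f N ℤ.+ alternatingSum g N) ℤ.+ (ε ℤ.* (+ f N) ℤ.+ ε ℤ.* (+ g N))
    ≡⟨ interchange ℤ.+-commutativeSemigroup (alternatingSum f N) _ _ _ ⟩
  alternatingSum f (suc N) ℤ.+ alternatingSum g (suc N) ∎
  where
  open ≡-Reasoning
  ε = -1ℤ ℤ.^ N

-- The definition splits off the top term. Splitting off the bottom one instead turns a shift of
-- dimension by one, which is the effect of a moving block, into a change of sign.
alternatingSum-suc : ∀ f N →
  alternatingSum f (suc N) ≡ + f 0 ℤ.- alternatingSum (f ∘ suc) N
alternatingSum-suc f zero    = begin
  0ℤ ℤ.+ 1ℤ ℤ.* (+ f 0) ≡⟨ ℤ.+-identityˡ _ ⟩
  1ℤ ℤ.* (+ f 0)        ≡⟨ ℤ.*-identityˡ _ ⟩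
  + f 0                 ≡⟨ ℤ.+-identityʳ _ ⟨
  + f 0 ℤ.+ 0ℤ          ∎
  where open ≡-Reasoning
alternatingSum-suc f (suc N) = begin
  alternatingSum f (suc N) ℤ.+ (-1ℤ ℤ.* ε) ℤ.* x
    ≡⟨ cong₂ ℤ._+_ (alternatingSum-suc f N) (trans (ℤ.*-assoc -1ℤ ε x) (ℤ.-1*i≡-i (ε ℤ.* x))) ⟩
  (+ f 0 ℤ.- S) ℤ.+ (ℤ.- (ε ℤ.* x))
    ≡⟨ ℤ.+-assoc (+ f 0) (ℤ.- S) (ℤ.- (ε ℤ.* x)) ⟩
  + f 0 ℤ.+ (ℤ.- S ℤ.+ (ℤ.- (ε ℤ.* x)))
    ≡⟨ cong (λ z → + f 0 ℤ.+ z) (ℤ.neg-distrib-+ S (ε ℤ.* x)) ⟨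
  + f 0 ℤ.- (S ℤ.+ ε ℤ.* x) ∎
  where
  open ≡-Reasoning
  ε = -1ℤ ℤ.^ N
  x = + f (suc N)
  S = alternatingSum (f ∘ suc) N

χ : {A : ℕ → Set} → ((k : ℕ) → List (A k)) → ℕ → ℤ
χ xs = alternatingSum (λ k → length (xs k))

χ-map : {A B : ℕ → Set} (f : ∀ {k} → A k → B k) (xs : ∀ k → List (A k)) → ∀ N →
  χ (λ k → List.map f (xs k)) N ≡ χ xs N
χ-map f xs = alternatingSum-cong (λ k → length-map f (xs k))

χ-++ : {A : ℕ → Set} (xs ys : ∀ k → List (A k)) → ∀ N →
  χ (λ k → xs k ++ ys k) N ≡ χ xs N ℤ.+ χ ys N
χ-++ xs ys N = trans
  (alternatingSum-cong (λ k → length-++ (xs k)) N)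
  (alternatingSum-+ (λ k → length (xs k)) (λ k → length (ys k)) N)

-- The signed number of patterns

-- The bounds on `N` make the sums cover every dimension that occurs. A fixed first link keeps the
-- value 1, and a moving first block turns it into -1. The two cancel for each vertical link, so
-- `χ-vertical` gives 0 whichever vertical links are admissible, and the patterns beginning with a
-- fixed r contribute the 1.
χ-rigid    : ∀ n y l {N} → n ℕ.< N →
  χ (λ k → List.map (Pattern._∷_ l) (patterns n k (y ℤ.+ rise l) l)) N ≡ 1ℤ
χ-patterns : ∀ n y p {N} → n ℕ.< N → χ (λ k → patterns n k y p) N ≡ 1ℤ
χ-bent     : ∀ n y (ver : Vertical v) {N} → suc n ℕ.< N → χ (λ k → bent n k y ver) N ≡ -1ℤ
χ-vertical : ∀ n y vs {N} → suc n ℕ.< N → χ (λ k → concatMap (vertical n k y) vs) N ≡ 0ℤ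

χ-rigid n y l {N} n<N = trans
  (χ-map (l ∷_) (λ k → patterns n k (y ℤ.+ rise l) l) N)
  (χ-patterns n (y ℤ.+ rise l) l n<N)

χ-patterns zero y p {suc N} _ = trans
  (alternatingSum-suc (λ k → length (patterns 0 k y p)) N)
  (cong (λ z → 1ℤ ℤ.- z) (alternatingSum-0 N))
χ-patterns (suc n) y p {N} n<N = trans
  (χ-++ (λ k → List.map (r ∷_) (patterns n k (y ℤ.+ rise r) r))
        (λ k → concatMap (vertical n k y) (turns y p)) N)
  (cong₂ ℤ._+_ (χ-rigid n y r (ℕ.<⇒≤ n<N)) (χ-vertical n y (turns y p) n<N))

χ-bent n y ver {suc zero} (s≤s ())
-- The only bent pattern of length 1 is `end ver`, of dimension 1, so the sum is 0 - (1 - 0).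
χ-bent zero y ver {suc (suc N)} _ = trans
  (alternatingSum-suc (λ k → length (bent 0 k y ver)) (suc N))
  (cong (λ z → 0ℤ ℤ.- z) (trans
    (alternatingSum-suc (λ k → length (bent 0 (suc k) y ver)) N)
    (cong (λ z → 1ℤ ℤ.- z) (alternatingSum-0 N))))
χ-bent {v = v} (suc n) y ver {suc N} (s≤s n<N) = trans
  (alternatingSum-suc (λ k → length (bent (suc n) k y ver)) N)
  (cong (λ z → 0ℤ ℤ.- z) (trans
    (χ-map (swap ver) (λ k → patterns n k (y ℤ.+ rise v) v) N)
    (χ-patterns n (y ℤ.+ rise v) v (ℕ.<⇒≤ n<N))))

χ-vertical n y []               {N} n<N = alternatingSum-0 N
χ-vertical n y ((v , ver) ∷ vs) {N} n<N = trans
  (χ-++ (λ k → vertical n k y (v , ver)) (λ k → concatMap (vertical n k y) vs) N)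
  (cong₂ ℤ._+_
    (trans
      (χ-++ (λ k → List.map (v ∷_) (patterns n k (y ℤ.+ rise v) v)) (λ k → bent n k y ver) N)
      (cong₂ ℤ._+_ (χ-rigid n y v (ℕ.<⇒≤ n<N)) (χ-bent n y ver n<N)))
    (χ-vertical n y vs n<N))

-- Soundness and completeness of the enumeration

inRange : ∀ y (w : Vec Link n) → InStrip y w → InRange y
inRange y []      y∈         = y∈
inRange y (_ ∷ _) (y∈ , _) = y∈

continues-∷ : InRange y → ¬ Opposite p l → Continues (y ℤ.+ rise l) l w → Continues y p (l ∷ w)
continues-∷ y∈ ¬opp (links , strip) = ¬opp ∷ links , y∈ , strip

continues-tail : Continues y p (l ∷ w) → Continues (y ℤ.+ rise l) l w
continues-tail (links , strip) = Linked.tail links , proj₂ strip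

¬Opposite-r : ¬ Opposite p r
¬Opposite-r ()

continues-r∷ : InRange y → Continues y r w → Continues y p (r ∷ w)
continues-r∷ {y} {w = w} y∈ c =
  continues-∷ y∈ ¬Opposite-r (subst (λ z → Continues z r w) (sym (ℤ.+-identityʳ y)) c)

-- Serves the vertex vr of a swap, whose rest follows r although it was chosen to follow v.
continues-from-r : Continues y p w → Continues y r w
continues-from-r ([-] , strip)       = [-] , strip
continues-from-r (_ ∷ links , strip) = (λ ()) ∷ links , strip

continues-admissible : (ver : Vertical v) → Continues y p (v ∷ w) → Admissible y p (v , ver)
continues-admissible {w = w} _ (links , _ , strip) = inRange _ w strip , Linked.head links

InRange-+0 : InRange y → InRange (y ℤ.+ 0ℤ)
InRange-+0 {y} = subst InRange (sym (ℤ.+-identityʳ y))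

patterns-sound : ∀ n {k} {P : Pattern n k} → InRange y → P ∈ patterns n k y p →
                 ∀ {w} → Vertex P w → Continues y p w
vertical-sound : ∀ n {k} {P : Pattern (suc n) k} {ver : Vertical v} → InRange y → Admissible y p (v , ver) →
                 P ∈ vertical n k y (v , ver) → ∀ {w} → Vertex P w → Continues y p w
bent-sound     : ∀ n {k} {P : Pattern (suc n) k} (ver : Vertical v) → InRange y → Admissible y p (v , ver) →
                 P ∈ bent n k y ver → ∀ {w} → Vertex P w → Continues y p w

patterns-sound zero {zero} y∈ (here refl) [] = [-] , y∈
patterns-sound {y} {p} (suc n) {k} y∈ P∈ x
  with ∈-++⁻ (List.map (r ∷_) (patterns n k (y ℤ.+ rise r) r)) P∈
... | inj₂ P∈′ with find (∈-concatMap⁻ (vertical n k y) {xs = turns y p} P∈′)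
...   | v , v∈ , P∈″ = vertical-sound n y∈ (proj₂ (∈-filter⁻ (admissible? y p) {xs = verticals} v∈)) P∈″ x
patterns-sound (suc n) {k} y∈ P∈ x | inj₁ P∈′ with ∈-map⁻ (r ∷_) P∈′
patterns-sound (suc n) {k} y∈ P∈ (.r ∷ x) | inj₁ P∈′ | P , P∈″ , refl =
  continues-∷ y∈ ¬Opposite-r (patterns-sound n (InRange-+0 y∈) P∈″ x)

vertical-sound {v} {y} n {k} {ver = ver} y∈ adm P∈ x
  with ∈-++⁻ (List.map (v ∷_) (patterns n k (y ℤ.+ rise v) v)) P∈
... | inj₂ P∈′ = bent-sound n ver y∈ adm P∈′ x
... | inj₁ P∈′ with ∈-map⁻ (v ∷_) P∈′
vertical-sound n y∈ (y′∈ , ¬opp) P∈ (_ ∷ x) | inj₁ P∈′ | P , P∈″ , refl =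
  continues-∷ y∈ ¬opp (patterns-sound n y′∈ P∈″ x)

bent-sound zero    {suc zero} ver y∈ (y′∈ , ¬opp) (here refl) (endʰ _) =
  continues-r∷ y∈ ([-] , y∈)
bent-sound zero    {suc zero} ver y∈ (y′∈ , ¬opp) (here refl) (endᵛ _) =
  continues-∷ y∈ ¬opp ([-] , y′∈)
bent-sound (suc n) {suc k} ver y∈ (y′∈ , ¬opp) P∈ x with ∈-map⁻ (swap ver) P∈
bent-sound (suc n) {suc k} ver y∈ (y′∈ , ¬opp) P∈ (swapʰ _ x) | P , P∈′ , refl =
  continues-r∷ y∈ (continues-∷ y∈ (λ ()) (patterns-sound n y′∈ P∈′ x))
bent-sound (suc n) {suc k} ver y∈ (y′∈ , ¬opp) P∈ (swapᵛ _ x) | P , P∈′ , refl =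
  continues-∷ y∈ ¬opp (continues-r∷ y′∈ (continues-from-r (patterns-sound n y′∈ P∈′ x)))

∈-verticals : ∀ v → v ∈ verticals
∈-verticals (u , u) = here refl
∈-verticals (d , d) = there (here refl)

vertical⊆patterns : ∀ n k y p {P : Pattern (suc n) k} (ver : Vertical v) → Admissible y p (v , ver) →
                    P ∈ vertical n k y (v , ver) → P ∈ patterns (suc n) k y p
vertical⊆patterns n k y p ver adm P∈ =
  ∈-++⁺ʳ (List.map (r ∷_) (patterns n k (y ℤ.+ rise r) r))
    (∈-concatMap⁺ (vertical n k y) (lose (∈-filter⁺ (admissible? y p) (∈-verticals (_ , ver)) adm) P∈))

-- The hypothesis ranges over all vertices because different ones witness different constraints. For
-- a swap, the vertex vr shows that v is admissible after `p`, and the vertices rv show that the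
-- rest continues a path ending in v.
patterns-complete : (P : Pattern n k) → (∀ {w} → Vertex P w → Continues y p w) → P ∈ patterns n k y p
rigid-complete    : (ver : Vertical v) (P : Pattern n k) →
                    (∀ {w} → Vertex (v ∷ P) w → Continues y p w) → v ∷ P ∈ patterns (suc n) k y p

patterns-complete []      c = here refl
patterns-complete {n = suc n} (r ∷ P) c =
  ∈-++⁺ˡ (∈-map⁺ (r ∷_) (patterns-complete P (λ x → continues-tail (c (r ∷ x)))))
patterns-complete (u ∷ P) c = rigid-complete u P c
patterns-complete (d ∷ P) c = rigid-complete d P c
patterns-complete {y = y} {p} (end {v = v} ver) c =
  vertical⊆patterns 0 1 y p ver (continues-admissible ver (c (endᵛ ver))) (∈-++⁺ʳ (List.map (v ∷_) (patterns 0 1 (y ℤ.+ rise v) v)) (here refl))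
patterns-complete {n = suc (suc n)} {k = suc k} {y = y} {p} (swap {v = v} ver P) c =
  vertical⊆patterns (suc n) (suc k) y p ver (continues-admissible ver (c (swapᵛ ver (base-vertex P))))
    (∈-++⁺ʳ (List.map (v ∷_) (patterns (suc n) (suc k) (y ℤ.+ rise v) v)) (∈-map⁺ (swap ver) (patterns-complete P λ {w} x →
      subst (λ z → Continues (z ℤ.+ rise v) v w) (ℤ.+-identityʳ y)
        (continues-tail (continues-tail (c (swapʰ ver x)))))))

rigid-complete {v} {n} {k} {y} {p} ver P c =
  vertical⊆patterns n k y p ver (continues-admissible ver (c (v ∷ base-vertex P)))
    (∈-++⁺ˡ (∈-map⁺ (v ∷_) (patterns-complete P (λ x → continues-tail (c (v ∷ x))))))

-- The enumeration has no repetitions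

-- An invariant that separates the lists joined in `patterns`: it is v on the list for the vertical
-- link v, and r on the patterns that begin with a fixed r.
direction : Pattern (suc n) k → Link
direction (end {v = v} _)    = v
direction (l ∷ _)            = l
direction (swap {v = v} _ _) = v

bent-direction : ∀ n k {P : Pattern (suc n) k} {ver : Vertical v} → P ∈ bent n k y ver → direction P ≡ v
bent-direction zero    (suc zero) (here refl) = refl
bent-direction (suc n) (suc k) {ver = ver} P∈ with ∈-map⁻ (swap ver) P∈
... | _ , _ , refl = refl

vertical-direction : ∀ n k {P : Pattern (suc n) k} {ver : Vertical v} →
                     P ∈ vertical n k y (v , ver) → direction P ≡ v
vertical-direction {v} {y} n k P∈ with ∈-++⁻ (List.map (v ∷_) (patterns n k (y ℤ.+ rise v) v)) P∈
... | inj₂ P∈′ = bent-direction n k P∈′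
... | inj₁ P∈′ with ∈-map⁻ (v ∷_) P∈′
...   | _ , _ , refl = refl

rigid∉bent : ∀ n k {P : Pattern n k} {ver : Vertical v} → ¬ (l ∷ P ∈ bent n k y ver)
rigid∉bent zero (suc zero) (here ())
rigid∉bent zero (suc zero) (there ())
rigid∉bent (suc n) (suc k) {ver = ver} P∈ with ∈-map⁻ (swap ver) P∈
... | _ , _ , ()

concatMap-unique : (f : A → List B) → (∀ {a b y} → y ∈ f a → y ∈ f b → a ≡ b) → (∀ a → Unique (f a)) →
                   ∀ {xs} → Unique xs → Unique (concatMap f xs)
concatMap-unique f f-separates f-unique {xs} xs-unique = Unique.concat⁺
  (ListAll.map⁺ (ListAll.universal f-unique xs))
  (ListAllPairs.map⁺ (ListAllPairs.map (λ a≢b {_} (y∈fa , y∈fb) → a≢b (f-separates y∈fa y∈fb)) xs-unique))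

verticals-unique : Unique verticals
verticals-unique = ((λ ()) ∷ []) ∷ [] ∷ []

∃Vertical-≡ : {a b : ∃ Vertical} → proj₁ a ≡ proj₁ b → a ≡ b
∃Vertical-≡ {_ , p} {_ , q} refl = cong (_ ,_) (Vertical-irrelevant p q)

patterns-unique : ∀ n k y p → Unique (patterns n k y p)
vertical-unique : ∀ n k y v → Unique (vertical n k y v)
bent-unique     : ∀ n k y (ver : Vertical v) → Unique (bent n k y ver)

patterns-unique zero    zero    y p = [] ∷ []
patterns-unique zero    (suc k) y p = []
patterns-unique (suc n) k       y p = Unique.++⁺
  (Unique.map⁺ (λ { refl → refl }) (patterns-unique n k _ r))
  (concatMap-unique (vertical n k y)
    (λ P∈a P∈b → ∃Vertical-≡ (trans (sym (vertical-direction n k P∈a)) (vertical-direction n k P∈b)))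
    (vertical-unique n k y)
    (Unique.filter⁺ (admissible? y p) verticals-unique))
  disjoint
  where
  disjoint : ∀ {P} → ¬ (P ∈ List.map (r ∷_) (patterns n k (y ℤ.+ rise r) r) × P ∈ concatMap (vertical n k y) (turns y p))
  disjoint (P∈ , P∈′) with ∈-map⁻ (r ∷_) P∈ | find (∈-concatMap⁻ (vertical n k y) {xs = turns y p} P∈′)
  ... | _ , _ , refl | (v , ver) , _ , P∈″ with vertical-direction n k P∈″
  disjoint (P∈ , P∈′) | _ , _ , refl | (.r , ()) , _ , P∈″ | refl

vertical-unique n k y (v , ver) = Unique.++⁺
  (Unique.map⁺ (λ { refl → refl }) (patterns-unique n k _ v))
  (bent-unique n k y ver)
  disjoint
  where
  disjoint : ∀ {P} → ¬ (P ∈ List.map (v ∷_) (patterns n k (y ℤ.+ rise v) v) × P ∈ bent n k y ver)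
  disjoint (P∈ , P∈′) with ∈-map⁻ (v ∷_) P∈
  ... | _ , _ , refl = rigid∉bent n k P∈′

bent-unique n       zero          y ver = []
bent-unique zero    (suc zero)    y ver = [] ∷ []
bent-unique zero    (suc (suc k)) y ver = []
bent-unique {v} (suc n) (suc k)   y ver = Unique.map⁺ (λ { refl → refl }) (patterns-unique n k _ v)

lookup-injective : {xs : List A} → Unique xs → ∀ {i j} → List.lookup xs i ≡ List.lookup xs j → i ≡ j
lookup-injective (_ ∷ _)      {zero}  {zero}  _  = refl
lookup-injective (x∉ ∷ _)     {zero}  {suc j} eq = contradiction eq (ListAll.lookup x∉ (∈-lookup j))
lookup-injective (x∉ ∷ _)     {suc i} {zero}  eq = contradiction (sym eq) (ListAll.lookup x∉ (∈-lookup i))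
lookup-injective (_ ∷ unique) {suc i} {suc j} eq = cong suc (lookup-injective unique eq)

-- From patterns to cubes

private
  variable
    P Q : Pattern n k

lift : Move n → Move (suc n)
lift (switch i)         = switch (suc i)
lift {n = suc _} (flip l) = flip l

perform-lift : ∀ (m : Move n) l w → perform (lift m) (l ∷ w) ≡ l ∷ perform m w
perform-lift (switch i) l w = refl
perform-lift {n = suc _} (flip _) l w = refl

performSubset-lift : ∀ (ms : Vec (Move n) k) s l w →
  performSubset (Vec.map lift ms) s (l ∷ w) ≡ l ∷ performSubset ms s w
performSubset-lift []       []          l w = refl
performSubset-lift (m ∷ ms) (true  ∷ s) l w =
  trans (cong (performSubset (Vec.map lift ms) s) (perform-lift m l w)) (performSubset-lift ms s l (perform m w))
performSubset-lift (m ∷ ms) (false ∷ s) l w = performSubset-lift ms s l w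

turns-lift : ∀ (m : Move n) {l w} → Turns m w → Turns (lift m) (l ∷ w)
turns-lift (switch i) t = t
turns-lift {n = suc _} (flip _) t = t

turns-lift⁻ : ∀ (m : Move n) {l w} → Turns (lift m) (l ∷ w) → Turns m w
turns-lift⁻ (switch i) t = t
turns-lift⁻ {n = suc _} (flip _) t = t

links-lift⁺ : ∀ (m : Move n) {j} → links m j → links (lift m) (suc j)
links-lift⁺ (switch i) (inj₁ refl) = inj₁ refl
links-lift⁺ (switch i) (inj₂ refl) = inj₂ refl
links-lift⁺ {n = suc _} (flip _) refl = refl

links-lift⁻ : ∀ (m : Move n) {j} → links (lift m) (suc j) → links m j
links-lift⁻ (switch i) (inj₁ refl) = inj₁ refl
links-lift⁻ (switch i) (inj₂ refl) = inj₂ refl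
links-lift⁻ {n = suc _} (flip _) refl = refl

zero∉links-lift : ∀ (m : Move n) → ¬ links (lift m) zero
zero∉links-lift (switch i) (inj₁ ())
zero∉links-lift (switch i) (inj₂ ())
zero∉links-lift {n = suc _} (flip _) ()

disjoint-lift : ∀ (m m′ : Move n) → links m ⊥ links m′ → links (lift m) ⊥ links (lift m′)
disjoint-lift m m′ m⊥m′ {zero}  (j∈ , _)   = zero∉links-lift m j∈
disjoint-lift m m′ m⊥m′ {suc j} (j∈ , j∈′) = m⊥m′ (links-lift⁻ m j∈ , links-lift⁻ m′ j∈′)

disjoint-lift⁻ : ∀ (m m′ : Move n) → links (lift m) ⊥ links (lift m′) → links m ⊥ links m′
disjoint-lift⁻ m m′ m⊥m′ (j∈ , j∈′) = m⊥m′ (links-lift⁺ m j∈ , links-lift⁺ m′ j∈′)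

-- Matches `base`, in which every moving block has r in front: each move brings its block into the
-- other state.
moves : Pattern n k → Vec (Move n) k
moves []                 = []
moves (end {v = v} _)    = flip v ∷ []
moves (_ ∷ P)            = Vec.map lift (moves P)
moves (swap _ P)         = switch zero ∷ Vec.map lift (Vec.map lift (moves P))

performSubset-lift² : ∀ (ms : Vec (Move n) k) s l l′ w →
  performSubset (Vec.map lift (Vec.map lift ms)) s (l ∷ l′ ∷ w) ≡ l ∷ l′ ∷ performSubset ms s w
performSubset-lift² ms s l l′ w =
  trans (performSubset-lift (Vec.map lift ms) s l (l′ ∷ w)) (cong (l ∷_) (performSubset-lift ms s l′ w))

-- Subsets of the moves correspond to vertices block by block: a selected move puts its block into
-- the state marked ᵛ, an unselected one leaves it in the state marked ʰ.
moves-sound : (P : Pattern n k) → ∀ s → Vertex P (performSubset (moves P) s (base P))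
moves-sound []        []          = []
moves-sound (end ver) (true  ∷ []) = endᵛ ver
moves-sound (end ver) (false ∷ []) = endʰ ver
moves-sound (l ∷ P)   s = subst (Vertex (l ∷ P)) (sym (performSubset-lift (moves P) s l (base P))) (l ∷ moves-sound P s)
moves-sound (swap ver P) (true ∷ s) =
  subst (Vertex (swap ver P)) (sym (performSubset-lift² (moves P) s _ r (base P))) (swapᵛ ver (moves-sound P s))
moves-sound (swap ver P) (false ∷ s) =
  subst (Vertex (swap ver P)) (sym (performSubset-lift² (moves P) s r _ (base P))) (swapʰ ver (moves-sound P s))

moves-complete : Vertex P w → ∃ λ s → performSubset (moves P) s (base P) ≡ w
moves-complete []         = [] , refl
moves-complete (endʰ ver) = false ∷ [] , refl
moves-complete (endᵛ ver) = true ∷ [] , refl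
moves-complete (_∷_ l {P} x) with moves-complete x
... | s , refl = s , performSubset-lift (moves P) s l (base P)
moves-complete (swapʰ ver {P} x) with moves-complete x
... | s , refl = false ∷ s , performSubset-lift² (moves P) s r _ (base P)
moves-complete (swapᵛ ver {P} x) with moves-complete x
... | s , refl = true ∷ s , performSubset-lift² (moves P) s _ r (base P)

-- `Vertex P` stands in for `IsPosition`, which prescribes the initial height 0 and so does not pass
-- to the rest of a word. In `cube` all vertices are positions, which gives applicability.
moves-applicable : (P : Pattern n k) →
  All (λ m → Turns m (base P) × Vertex P (perform m (base P))) (moves P)
moves-applicable []        = []
moves-applicable (end ver) = (inj₂ (r , ver) , endᵛ ver) ∷ []
moves-applicable (l ∷ P)   = VecAll.gmap
  (λ {m} (t , x) → turns-lift m t , subst (Vertex _) (sym (perform-lift m l (base P))) (l ∷ x))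
  (moves-applicable P)
moves-applicable (swap {v = v} ver P) = (inj₂ (r , ver) , swapᵛ ver (base-vertex P)) ∷
  VecAll.gmap
    (λ {m} (t , x) → turns-lift m t ,
      subst (Vertex _) (sym (perform-lift m r (v ∷ base P))) x)
    (VecAll.gmap {P = λ m → Turns m (base P) × Vertex P (perform m (base P))}
              {Q = λ m → Turns m (v ∷ base P) × Vertex (swap ver P) (r ∷ perform m (v ∷ base P))}
      (λ {m} (t , x) → turns-lift m t ,
        subst (λ z → Vertex (swap ver P) (r ∷ z)) (sym (perform-lift m v (base P))) (swapʰ ver x))
      (moves-applicable P))

switch-zero⊥lift² : (m : Move n) → links (switch zero) ⊥ links (lift (lift m))
switch-zero⊥lift² m (inj₁ refl , j∈) = zero∉links-lift (lift m) j∈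
switch-zero⊥lift² m (inj₂ refl , j∈) = zero∉links-lift m (links-lift⁻ (lift m) j∈)

map-lift-disjoint : {ms : Vec (Move n) k} → AllPairs (λ m m′ → links m ⊥ links m′) ms →
                    AllPairs (λ m m′ → links m ⊥ links m′) (Vec.map lift ms)
map-lift-disjoint = VecAllPairs.map⁺ ∘ VecAllPairs.map (λ {m} {m′} → disjoint-lift m m′)

moves-disjoint : (P : Pattern n k) → AllPairs (λ m m′ → links m ⊥ links m′) (moves P)
moves-disjoint []         = []
moves-disjoint (end _)    = [] ∷ []
moves-disjoint (_ ∷ P)    = map-lift-disjoint (moves-disjoint P)
moves-disjoint (swap _ P) =
  VecAll.map⁺ (VecAll.map⁺ (VecAll.universal switch-zero⊥lift² (moves P))) ∷
  map-lift-disjoint (map-lift-disjoint (moves-disjoint P))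

cube : (P : Pattern n k) → Vertex P ⊆ IsPosition → Cube n k
cube P positions = record
  { base       = base P
  ; isPosition = positions (base-vertex P)
  ; moves      = moves P
  ; applicable = VecAll.map (map₂ positions) (moves-applicable P)
  ; disjoint   = moves-disjoint P
  ; commute    = λ s → positions (moves-sound P s)
  }

cube-vertices : (P : Pattern n k) (positions : Vertex P ⊆ IsPosition) →
                Cube.vertices (cube P positions) ≐ Vertex P
cube-vertices P _ = (λ { (s , refl) → moves-sound P s }) , moves-complete

-- Disjoint moves commute

-- Drives the inductions along the path: a move either uses the first link or is a move on the
-- remaining links.
data View : Move (suc n) → Set where
  first  : {m : Move (suc n)} → links m zero → View m
  lifted : (m : Move n) → View (lift m)

view : (m : Move (suc n)) → View m
view (switch zero)    = first (inj₁ refl)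
view (switch (suc i)) = lifted (switch i)
view {zero}  (flip l) = first refl
view {suc n} (flip l) = lifted (flip l)

-- Of two disjoint moves at most one uses the first link. If one does, it is a switch of the first
-- two links and the other acts beyond them, so both orders compute to the same word; otherwise both
-- act on the tail.
perform-comm : ∀ (m m′ : Move n) → links m ⊥ links m′ → ∀ w →
  perform m (perform m′ w) ≡ perform m′ (perform m w)
perform-comm-first : ∀ (m : Move (suc n)) (m′ : Move n) → links m zero → links m ⊥ links (lift m′) → ∀ w →
  perform m (perform (lift m′) w) ≡ perform (lift m′) (perform m w)

perform-comm {zero}  () _
perform-comm {suc n} m m′ m⊥m′ w with view m | view m′
... | first 0∈   | first 0∈′  = ⊥-elim (m⊥m′ (0∈ , 0∈′))
... | first 0∈   | lifted m₁′ = perform-comm-first m m₁′ 0∈ m⊥m′ w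
... | lifted m₁  | first 0∈′  = sym (perform-comm-first m′ m₁ 0∈′ (λ (a , b) → m⊥m′ (b , a)) w)
perform-comm {suc n} m m′ m⊥m′ (l ∷ w) | lifted m₁  | lifted m₁′ = begin
  perform (lift m₁) (perform (lift m₁′) (l ∷ w)) ≡⟨ cong (perform (lift m₁)) (perform-lift m₁′ l w) ⟩
  perform (lift m₁) (l ∷ perform m₁′ w)          ≡⟨ perform-lift m₁ l _ ⟩
  l ∷ perform m₁ (perform m₁′ w)                 ≡⟨ cong (l ∷_) (perform-comm m₁ m₁′ (disjoint-lift⁻ m₁ m₁′ m⊥m′) w) ⟩
  l ∷ perform m₁′ (perform m₁ w)                 ≡⟨ perform-lift m₁′ l _ ⟨
  perform (lift m₁′) (l ∷ perform m₁ w)          ≡⟨ cong (perform (lift m₁′)) (perform-lift m₁ l w) ⟨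
  perform (lift m₁′) (perform (lift m₁) (l ∷ w)) ∎
  where open ≡-Reasoning

perform-comm-first (switch zero)    (switch zero)    0∈ m⊥m′ w = ⊥-elim (m⊥m′ (inj₂ refl , inj₁ refl))
perform-comm-first (switch zero)    (switch (suc i)) 0∈ m⊥m′ (_ ∷ _ ∷ w) = refl
perform-comm-first (switch (suc i)) m′ 0∈ m⊥m′ w = ⊥-elim (zero∉links-lift (switch i) 0∈)
perform-comm-first {suc zero}    (switch zero) (flip l) 0∈ m⊥m′ w = ⊥-elim (m⊥m′ (inj₂ refl , refl))
perform-comm-first {suc (suc n)} (switch zero) (flip l) 0∈ m⊥m′ (_ ∷ _ ∷ w) = refl
perform-comm-first {suc n} (flip l) m′ () m⊥m′ w

-- `performSubset` performs the head of the list first, whereas adding this move to the pattern of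
-- the others performs it last. Disjointness reconciles the two orders.
performSubset-comm : ∀ (m : Move n) {ms : Vec (Move n) k} → All (λ m′ → links m ⊥ links m′) ms → ∀ s w →
  performSubset ms s (perform m w) ≡ perform m (performSubset ms s w)
performSubset-comm m []             []          w = refl
performSubset-comm m {m′ ∷ ms} (m⊥m′ ∷ m⊥ms) (true  ∷ s) w =
  trans (cong (performSubset ms s) (perform-comm m′ m (λ (a , b) → m⊥m′ (b , a)) w))
        (performSubset-comm m m⊥ms s (perform m′ w))
performSubset-comm m (_ ∷ m⊥ms)     (false ∷ s) w = performSubset-comm m m⊥ms s w

lookup-perform : ∀ (m : Move n) {j} → ¬ links m j → ∀ w → lookup (perform m w) j ≡ lookup w j
lookup-perform (switch i) j∉ w = trans
  (lookup∘update′ (j∉ ∘ inj₂) (w [ inject₁ i ]≔ _) _)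
  (lookup∘update′ (j∉ ∘ inj₁) w _)
lookup-perform {suc n} (flip l) j∉ w = lookup∘update′ j∉ w l

lookup-performSubset : ∀ {ms : Vec (Move n) k} {j} → All (λ m → ¬ links m j) ms → ∀ s w →
  lookup (performSubset ms s w) j ≡ lookup w j
lookup-performSubset []         []          w = refl
lookup-performSubset {ms = m ∷ _} (j∉ ∷ j∉s) (true  ∷ s) w =
  trans (lookup-performSubset j∉s s (perform m w)) (lookup-perform m j∉ w)
lookup-performSubset (_ ∷ j∉s) (false ∷ s) w = lookup-performSubset j∉s s w

-- From cubes to patterns

-- The pattern of a cube arises from that of its base, all of whose links are
-- fixed, by inserting the moves one by one; disjointness ensures that the links
-- of each new move are still fixed.
record Extends (m : Move n) (P : Pattern n k) (Q : Pattern n (suc k)) : Set where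
  field
    old   : ∀ {w} → Vertex P w → Vertex Q w
    new   : ∀ {w} → Vertex P w → Vertex Q (perform m w)
    cover : ∀ {w} → Vertex Q w → Vertex P w ⊎ ∃ λ w′ → Vertex P w′ × perform m w′ ≡ w

open Extends

extends-∷ : ∀ {m : Move n} l → Extends m P Q → Extends (lift m) (l ∷ P) (l ∷ Q)
extends-∷ _ e .old (l ∷ x) = l ∷ e .old x
extends-∷ {Q = Q} {m = m} _ e .new (l ∷ x) = subst (Vertex (l ∷ Q)) (sym (perform-lift m l _)) (l ∷ e .new x)
extends-∷ {m = m} _ e .cover (l ∷ x) with e .cover x
... | inj₁ x′            = inj₁ (l ∷ x′)
... | inj₂ (_ , x′ , refl) = inj₂ (_ , l ∷ x′ , perform-lift m l _)

perform-lift² : ∀ (m : Move n) l l′ w → perform (lift (lift m)) (l ∷ l′ ∷ w) ≡ l ∷ l′ ∷ perform m w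
perform-lift² m l l′ w = trans (perform-lift (lift m) l _) (cong (l ∷_) (perform-lift m l′ w))

extends-swap : ∀ {m : Move n} (ver : Vertical v) → Extends m P Q → Extends (lift (lift m)) (swap ver P) (swap ver Q)
extends-swap _ e .old (swapʰ ver x) = swapʰ ver (e .old x)
extends-swap _ e .old (swapᵛ ver x) = swapᵛ ver (e .old x)
extends-swap {Q = Q} {m = m} _ e .new (swapʰ ver x) =
  subst (Vertex (swap ver Q)) (sym (perform-lift² m r _ _)) (swapʰ ver (e .new x))
extends-swap {Q = Q} {m = m} _ e .new (swapᵛ ver x) =
  subst (Vertex (swap ver Q)) (sym (perform-lift² m _ r _)) (swapᵛ ver (e .new x))
extends-swap {m = m} _ e .cover (swapʰ ver x) with e .cover x
... | inj₁ x′            = inj₁ (swapʰ ver x′)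
... | inj₂ (_ , x′ , refl) = inj₂ (_ , swapʰ ver x′ , perform-lift² m r _ _)
extends-swap {m = m} _ e .cover (swapᵛ ver x) with e .cover x
... | inj₁ x′            = inj₁ (swapᵛ ver x′)
... | inj₂ (_ , x′ , refl) = inj₂ (_ , swapᵛ ver x′ , perform-lift² m _ r _)

-- A cube may be given from any of its vertices, so a new block can start in either state: vr or rv
-- for a switch, v or r for a flip.
extends-vr : (ver : Vertical v) → Extends (switch zero) (v ∷ r ∷ P) (swap ver P)
extends-vr ver .old (_ ∷ _ ∷ x)       = swapᵛ ver x
extends-vr ver .new (_ ∷ _ ∷ x)       = swapʰ ver x
extends-vr ver .cover (swapʰ _ x) = inj₂ (_ , _ ∷ _ ∷ x , refl)
extends-vr ver .cover (swapᵛ _ x) = inj₁ (_ ∷ _ ∷ x)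

extends-rv : (ver : Vertical v) → Extends (switch zero) (r ∷ v ∷ P) (swap ver P)
extends-rv ver .old (_ ∷ _ ∷ x)       = swapʰ ver x
extends-rv ver .new (_ ∷ _ ∷ x)       = swapᵛ ver x
extends-rv ver .cover (swapʰ _ x) = inj₁ (_ ∷ _ ∷ x)
extends-rv ver .cover (swapᵛ _ x) = inj₂ (_ , _ ∷ _ ∷ x , refl)

extends-v : (ver : Vertical v) → Extends (flip r) (v ∷ []) (end ver)
extends-v ver .old (_ ∷ [])       = endᵛ ver
extends-v ver .new (_ ∷ [])       = endʰ ver
extends-v ver .cover (endʰ _) = inj₂ (_ , _ ∷ [] , refl)
extends-v ver .cover (endᵛ _) = inj₁ (_ ∷ [])

extends-r : (ver : Vertical v) → Extends (flip v) (r ∷ []) (end ver)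
extends-r ver .old (_ ∷ [])       = endʰ ver
extends-r ver .new (_ ∷ [])       = endᵛ ver
extends-r ver .cover (endʰ _) = inj₁ (_ ∷ [])
extends-r ver .cover (endᵛ _) = inj₂ (_ , _ ∷ [] , refl)

Fixed : Pattern n k → Fin n → Set
Fixed P j = ∀ {w w′} → Vertex P w → Vertex P w′ → lookup w j ≡ lookup w′ j

fixed-tail : ∀ {j} → Fixed (l ∷ P) (suc j) → Fixed P j
fixed-tail {l} fix x x′ = fix (l ∷ x) (l ∷ x′)

¬fixed-swap₀ : {ver : Vertical v} → ¬ Fixed (swap ver P) zero
¬fixed-swap₀ {P = P} {ver = ver} fix with fix (swapʰ ver (base-vertex P)) (swapᵛ ver (base-vertex P))
¬fixed-swap₀ {ver = ()} _ | refl

¬fixed-swap₁ : {ver : Vertical v} → ¬ Fixed (swap ver P) (suc zero)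
¬fixed-swap₁ {P = P} {ver = ver} fix with fix (swapʰ ver (base-vertex P)) (swapᵛ ver (base-vertex P))
¬fixed-swap₁ {ver = ()} _ | refl

¬fixed-end : {ver : Vertical v} → ¬ Fixed (end ver) zero
¬fixed-end {ver = ver} fix with fix (endʰ ver) (endᵛ ver)
¬fixed-end {ver = ()} _ | refl

-- Links that agree in all vertices lie outside the moving blocks. So the recursion can pass the
-- blocks in front of `m` until `m` uses the first link, and `Turns` at the given vertex then tells
-- in which state the new block starts.
insert : (m : Move n) (P : Pattern n k) → Vertex P w → Turns m w → (∀ {j} → links m j → Fixed P j) →
         ∃ (Extends m P)
insert-first : (m : Move (suc n)) (P : Pattern n k) → links m zero → Vertex (l ∷ P) w → Turns m w →
               (∀ {j} → links m j → Fixed (l ∷ P) j) → ∃ (Extends m (l ∷ P))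

insert () [] _ _ _
insert m (end _) _ _ fix with view m
... | first 0∈ = ⊥-elim (¬fixed-end (fix 0∈))
... | lifted ()
insert m (l ∷ P) x t fix with view m
... | first 0∈ = insert-first m P 0∈ x t fix
insert m (l ∷ P) (_ ∷ x) t fix | lifted m′ =
  let Q , e = insert m′ P x (turns-lift⁻ m′ t) (λ j∈ → fixed-tail (fix (links-lift⁺ m′ j∈)))
  in l ∷ Q , extends-∷ l e
insert m (swap _ _) _ _ fix with view m
... | first 0∈ = ⊥-elim (¬fixed-swap₀ (fix 0∈))
... | lifted m′ with view m′
...   | first 0∈ = ⊥-elim (¬fixed-swap₁ (fix (links-lift⁺ m′ 0∈)))
insert m (swap ver P) x t fix | lifted _ | lifted m″ =
  let _ , y , t″ = below x t
      Q , e      = insert m″ P y t″ fix″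
  in swap ver Q , extends-swap ver e
  where
  fix″ : ∀ {j} → links m″ j → Fixed P j
  fix″ j∈ x x′ = fix (links-lift⁺ (lift m″) (links-lift⁺ m″ j∈)) (swapʰ ver x) (swapʰ ver x′)
  below : ∀ {w} → Vertex (swap ver P) w → Turns (lift (lift m″)) w → ∃ λ w′ → Vertex P w′ × Turns m″ w′
  below (swapʰ _ y) t = _ , y , turns-lift⁻ m″ (turns-lift⁻ (lift m″) t)
  below (swapᵛ _ y) t = _ , y , turns-lift⁻ m″ (turns-lift⁻ (lift m″) t)

insert-first (switch zero) (_ ∷ P) _ (_ ∷ _ ∷ _) (inj₁ (ver , r)) _ = swap ver P , extends-vr ver
insert-first (switch zero) (_ ∷ P) _ (_ ∷ _ ∷ _) (inj₂ (r , ver)) _ = swap ver P , extends-rv ver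
insert-first (switch zero) (end _)    _ _ _ fix = ⊥-elim (¬fixed-end (fixed-tail (fix (inj₂ refl))))
insert-first (switch zero) (swap _ _) _ _ _ fix = ⊥-elim (¬fixed-swap₀ (fixed-tail (fix (inj₂ refl))))
insert-first (switch (suc i)) _ 0∈ _ _ _ = ⊥-elim (zero∉links-lift (switch i) 0∈)
insert-first (flip _) [] _ (_ ∷ []) (inj₁ (ver , r)) _ = end ver , extends-v ver
insert-first (flip _) [] _ (_ ∷ []) (inj₂ (r , ver)) _ = end ver , extends-r ver
insert-first {suc n} (flip _) _ () _ _ _

rigid : Vec Link n → Pattern n 0
rigid []      = []
rigid (l ∷ w) = l ∷ rigid w

rigid-vertex : (w : Vec Link n) → Vertex (rigid w) w
rigid-vertex []      = []
rigid-vertex (l ∷ w) = l ∷ rigid-vertex w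

rigid-vertex⁻ : Vertex (rigid w) w′ → w ≡ w′
rigid-vertex⁻ {w = []}    []      = refl
rigid-vertex⁻ {w = l ∷ w} (_ ∷ x) = cong (l ∷_) (rigid-vertex⁻ x)

-- Induction on the list, with its head inserted last. This concerns words only; positions enter
-- again through `commute` when a cube is located in the enumeration.
pattern-of-moves : (ms : Vec (Move n) k) (w : Vec Link n) → All (λ m → Turns m w) ms →
  AllPairs (λ m m′ → links m ⊥ links m′) ms →
  ∃ λ (P : Pattern n k) → (λ w′ → ∃ λ s → performSubset ms s w ≡ w′) ≐ Vertex P
pattern-of-moves [] w _ _ =
  rigid w , (λ { ([] , refl) → rigid-vertex w }) , (λ x → [] , rigid-vertex⁻ x)
pattern-of-moves (m ∷ ms) w (t ∷ ts) (m⊥ms ∷ ms⊥ms) with pattern-of-moves ms w ts ms⊥ms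
... | P , P⊇ , P⊆ = P⁺ , P⁺⊇ , P⁺⊆
  where
  start : Vertex P (performSubset ms (Vec.replicate _ false) w)
  start = P⊇ (_ , refl)

  performSubset-∅ : ∀ {k} (ms : Vec (Move n) k) {w} → performSubset ms (Vec.replicate _ false) w ≡ w
  performSubset-∅ []       = refl
  performSubset-∅ (_ ∷ ms) = performSubset-∅ ms

  fixed : ∀ {j} → links m j → Fixed P j
  fixed j∈ x x′ = trans (stays x) (sym (stays x′))
    where
    stays : ∀ {w′} → Vertex P w′ → lookup w′ _ ≡ lookup w _
    stays x with P⊆ x
    ... | s , refl = lookup-performSubset (VecAll.map (λ m⊥m′ j∈′ → m⊥m′ (j∈ , j∈′)) m⊥ms) s w

  -- The empty subset shows that `w` itself is a vertex of `P`, and it is at `w` that `m` turns.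
  inserted : ∃ (Extends m P)
  inserted = insert m P (subst (Vertex P) (performSubset-∅ ms) start) t fixed

  P⁺ = proj₁ inserted
  e = proj₂ inserted

  P⁺⊇ : ∀ {w′} → (∃ λ s → performSubset (m ∷ ms) s w ≡ w′) → Vertex P⁺ w′
  P⁺⊇ (true  ∷ s , refl) = subst (Vertex P⁺) (sym (performSubset-comm m m⊥ms s w)) (e .new (P⊇ (s , refl)))
  P⁺⊇ (false ∷ s , refl) = e .old (P⊇ (s , refl))

  P⁺⊆ : ∀ {w′} → Vertex P⁺ w′ → ∃ λ s → performSubset (m ∷ ms) s w ≡ w′
  P⁺⊆ x with e .cover x
  ... | inj₁ x′ = let s , eq = P⊆ x′ in false ∷ s , eq
  ... | inj₂ (_ , x′ , refl) with P⊆ x′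
  ...   | s , refl = true ∷ s , performSubset-comm m m⊥ms s w

cube-pattern : (c : Cube n k) → ∃ λ (P : Pattern n k) → Cube.vertices c ≐ Vertex P
cube-pattern c =
  pattern-of-moves (Cube.moves c) (Cube.base c) (VecAll.map proj₁ (Cube.applicable c)) (Cube.disjoint c)

-- Counting the cubes

continues⇒position : Continues 0ℤ r w → IsPosition w
continues⇒position (links , strip) = record { nonIntersecting = Linked.tail links ; inStrip = strip }

position⇒continues : IsPosition w → Continues 0ℤ r w
position⇒continues {w = []}    pos = [-] , IsPosition.inStrip pos
position⇒continues {w = _ ∷ _} pos = (λ ()) ∷ IsPosition.nonIntersecting pos , IsPosition.inStrip pos

-- An index goes to the cube built from the pattern listed there. Injectivity holds as a vertex set
-- determines its pattern and no pattern is listed twice; surjectivity holds as every cube has the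
-- vertices of a pattern, and the list is complete.
cubes-cardinality : ∀ n k → HasCardinality (𝒮₂ n k) (length (patterns n k 0ℤ r))
cubes-cardinality n k = record
  { to        = to
  ; cong      = λ { {i} refl → 𝒮.refl {to i} }
  ; bijective = injective , surjective
  }
  where
  module 𝒮 = Setoid (𝒮₂ n k)

  Ps : List (Pattern n k)
  Ps = patterns n k 0ℤ r

  positions : ∀ i → Vertex (List.lookup Ps i) ⊆ IsPosition
  positions i x =
    continues⇒position (patterns-sound n (ℤ.+≤+ z≤n , ℤ.+≤+ z≤n) (∈-lookup i) x)

  to : Fin (length Ps) → Cube n k
  to i = cube (List.lookup Ps i) (positions i)

  to-vertices : ∀ i → Cube.vertices (to i) ≐ Vertex (List.lookup Ps i)
  to-vertices i = cube-vertices (List.lookup Ps i) (positions i)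

  injective : ∀ {i j} → to i 𝒮.≈ to j → i ≡ j
  injective {i} {j} (i⊆j , j⊆i) = lookup-injective (patterns-unique n k 0ℤ r)
    (Vertex-⊆⇒≡ _ _
      (λ x → proj₁ (to-vertices j) (i⊆j (proj₂ (to-vertices i) x)))
      (λ x → proj₁ (to-vertices i) (j⊆i (proj₂ (to-vertices j) x))))

  surjective : ∀ c → ∃ λ i → ∀ {j} → j ≡ i → to j 𝒮.≈ c
  surjective c with cube-pattern c
  ... | P , c⊆P , P⊆c = index P∈ , λ { refl → vertices-≐ (to (index P∈)) (lookup-index P∈) (to-vertices (index P∈)) }
    where
    P-positions : Vertex P ⊆ IsPosition
    P-positions x with P⊆c x
    ... | s , refl = Cube.commute c s

    P∈ : P ∈ Ps
    P∈ = patterns-complete P (λ x → position⇒continues (P-positions x))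

    -- Stated for a variable `Q`, so that the equation from `lookup-index` can be matched with
    -- `refl`.
    vertices-≐ : ∀ c′ {Q} → P ≡ Q → Cube.vertices c′ ≐ Vertex Q → c′ 𝒮.≈ c
    vertices-≐ _ refl (c′⊆P , P⊆c′) = (λ x → P⊆c (c′⊆P x)) , (λ x → P⊆c′ (c⊆P x))

length-empty : ¬ A → (xs : List A) → length xs ≡ 0
length-empty ¬a []      = refl
length-empty ¬a (x ∷ _) = contradiction x ¬a

theorem1p5 : (n : ℕ) → HasEulerCharacteristic (𝒮₂ n) 1ℤ
theorem1p5 n = record
  { count       = λ k → length (patterns n k 0ℤ r)
  ; cardinality = cubes-cardinality n
  -- The sum runs over k below the bound, hence over all dimensions up to n.
  ; bound       = suc n
  ; vanishing   = λ k n<k →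
      length-empty (λ P → ℕ.<⇒≱ n<k (dimension≤length P)) (patterns n k 0ℤ r)
  ; sum         = χ-patterns n 0ℤ r (ℕ.n<1+n n)
  }
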